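{- Let $k>1$ be an integer with $k\in\mathcal C_1$. Then $$2^k-1<a_k<2^{k+1}-1.$$ In particular $c_k/2^k\to0$ as $k\to\infty$ through $\mathcal C_1$. Furthermore, let $t_k$ be the multiplicative order of $2$ modulo $k$ and let $j_0\in\{0,1,\ldots,t_k-1\}$ be the (unique) integer with $2^{k+1}-1\equiv 2^{j_0}\pmod k$; put $s=\lfloor (k-1-j_0)/t_k\rfloor$ and $j_1=j_0+st_k$. Then $$a_k=2^{k+1}-1-2^{j_1}.$$
   Context: For a positive integer $k$, $a_k$ is the smallest positive multiple of $k$ whose sum of binary digits equals $k$, and $c_k=a_k/k$. For a positive integer $m$, $\mathcal C_m$ is the set of odd positive integers $k$ for which there exist integers $0\le j_1<j_2<\cdots<j_m\le m+k-2$ with $2^{k+m}-1\equiv \sum_{i=1}^m 2^{j_i}\pmod k$. -}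

module Defs where

open import Data.Digit using (Expansion; fromDigits; toDigits)
open import Data.Fin.Base using (Fin; zero; suc; toℕ)
import Data.Fin.Base as Fin
open import Data.Fin.Properties using (pigeonhole; toℕ-fromℕ<)
open import Data.Integer.Base using (+_)
open import Data.List.Base as List using ([]; _∷_)
open import Data.Nat.Base
open import Data.Nat.Coprimality using (Coprime; coprime-divisor)
import Data.Nat.Coprimality as Coprimality
open import Data.Nat.Divisibility
open import Data.Nat.DivMod
open import Data.Nat.ListAction using () renaming (sum to sumᴸ)
open import Data.Nat.Primality using (prime[2]; prime⇒irreducible)
open import Data.Nat.Properties
open import Data.Nat.Tactic.RingSolver using (solve-∀)
open import Data.Product.Base using (∃; ∃₂; _×_; _,_; proj₁; proj₂)
open import Data.Rational.Base as ℚ using (ℚ; 0ℚ)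
open import Data.Sum.Base using (inj₁; inj₂)
open import Data.Vec.Base as Vec using (Vec)
open import Data.Vec.Relation.Unary.All using (All)
open import Data.Vec.Relation.Unary.Linked using (Linked)
open import Function.Base using (_∘_)
open import Level using (0ℓ)
open import Relation.Binary.PropositionalEquality
open import Relation.Nullary using (¬_; yes; no; contradiction)
open import Relation.Nullary.Decidable using (_×-dec_)
open import Relation.Unary using (Pred; Decidable; _∈_)

IsLeast : Pred ℕ 0ℓ → Pred ℕ 0ℓ
IsLeast P n = P n × (∀ m → P m → n ≤ m)

least : {P : Pred ℕ 0ℓ} → Decidable P → ∀ n → P n → ∃ (IsLeast P)
least {P} P? zero    p = zero , p , λ _ _ → z≤n
least {P} P? (suc n) p with P? 0
... | yes p₀ = zero , p₀ , λ _ _ → z≤n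
... | no ¬p₀ with least (P? ∘ suc) n p
...   | m , q , min = suc m , q , λ
  { zero    p₀ → contradiction p₀ ¬p₀
  ; (suc l) pₗ → s≤s (min l pₗ)
  }

infix 4 _≡_[mod_]

_≡_[mod_] : ℕ → ℕ → ℕ → Set
m ≡ n [mod k ] = k ∣ ∣ m - n ∣

Odd : Pred ℕ 0ℓ
Odd k = ¬ 2 ∣ k

odd⇒coprime : ∀ {k} → Odd k → Coprime 2 k
odd⇒coprime odd (d∣2 , d∣k) with prime⇒irreducible prime[2] d∣2
... | inj₁ d≡1  = d≡1
... | inj₂ refl = contradiction d∣k odd

%≡%⇒≡[mod] : ∀ m n k .{{_ : NonZero k}} → m % k ≡ n % k → m ≡ n [mod k ]
%≡%⇒≡[mod] m n k eq = divides ∣ m / k - n / k ∣ (begin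
  ∣ m - n ∣
    ≡⟨ cong₂ ∣_-_∣ (m≡m%n+[m/n]*n m k) (m≡m%n+[m/n]*n n k) ⟩
  ∣ m % k + m / k * k - n % k + n / k * k ∣
    ≡⟨ cong (λ r → ∣ m % k + m / k * k - r + n / k * k ∣) eq ⟨
  ∣ m % k + m / k * k - m % k + n / k * k ∣
    ≡⟨ ∣m+n-m+o∣≡∣n-o∣ (m % k) _ _ ⟩
  ∣ m / k * k - n / k * k ∣
    ≡⟨ *-distribʳ-∣-∣ k (m / k) (n / k) ⟨
  ∣ m / k - n / k ∣ * k ∎)
  where open ≡-Reasoning

powers-eventually-periodic : ∀ b k .{{_ : NonZero k}} →
  ∃₂ λ i p → 0 < p × k ∣ b ^ i * ∣ b ^ p - 1 ∣
powers-eventually-periodic b k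
  with pigeonhole (n<1+n k) (λ i → (b ^ toℕ i) mod k)
... | i , j , i<j , eq = toℕ i , p , m<n⇒0<n∸m i<j , subst (k ∣_) diff k∣diff
  where
  p = toℕ j ∸ toℕ i

  eq% : b ^ toℕ j % k ≡ b ^ toℕ i % k
  eq% = begin
    b ^ toℕ j % k             ≡⟨ toℕ-fromℕ< (m%n<n _ k) ⟨
    toℕ ((b ^ toℕ j) mod k)   ≡⟨ cong toℕ eq ⟨
    toℕ ((b ^ toℕ i) mod k)   ≡⟨ toℕ-fromℕ< (m%n<n _ k) ⟩
    b ^ toℕ i % k             ∎
    where open ≡-Reasoning

  k∣diff : k ∣ ∣ b ^ toℕ j - b ^ toℕ i ∣
  k∣diff = %≡%⇒≡[mod] (b ^ toℕ j) (b ^ toℕ i) k eq%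

  diff : ∣ b ^ toℕ j - b ^ toℕ i ∣ ≡ b ^ toℕ i * ∣ b ^ p - 1 ∣
  diff = begin
    ∣ b ^ toℕ j - b ^ toℕ i ∣
      ≡⟨ cong₂ (λ e x → ∣ b ^ e - x ∣) (m+[n∸m]≡n (<⇒≤ i<j)) (*-identityʳ _) ⟨
    ∣ b ^ (toℕ i + p) - b ^ toℕ i * 1 ∣
      ≡⟨ cong (λ x → ∣ x - b ^ toℕ i * 1 ∣) (^-distribˡ-+-* b (toℕ i) p) ⟩
    ∣ b ^ toℕ i * b ^ p - b ^ toℕ i * 1 ∣
      ≡⟨ *-distribˡ-∣-∣ (b ^ toℕ i) _ _ ⟨
    b ^ toℕ i * ∣ b ^ p - 1 ∣ ∎
    where open ≡-Reasoning

PositivePeriod : ℕ → ℕ → Pred ℕ 0ℓ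
PositivePeriod b k t = 0 < t × b ^ t ≡ 1 [mod k ]

cancel-^ : ∀ {b k} → Coprime b k → ∀ i {x} → k ∣ b ^ i * x → k ∣ x
cancel-^ {k = k} c zero {x} d = subst (k ∣_) (*-identityˡ x) d
cancel-^ {b} {k} c (suc i) {x} d = cancel-^ c i
  (coprime-divisor (Coprimality.sym c) (subst (k ∣_) (*-assoc b (b ^ i) x) d))

leastPositivePeriod : ∀ b k .{{_ : NonZero k}} → Coprime b k →
                      ∃ (IsLeast (PositivePeriod b k))
leastPositivePeriod b k c with powers-eventually-periodic b k
... | i , p , 0<p , k∣ =
  least (λ t → (0 <? t) ×-dec (k ∣? ∣ b ^ t - 1 ∣)) p (0<p , cancel-^ c i k∣)

order : ∀ b k .{{_ : NonZero k}} → Coprime b k → ℕ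
order b k c = proj₁ (leastPositivePeriod b k c)

order-isLeast : ∀ b k .{{_ : NonZero k}} (c : Coprime b k) →
                IsLeast (PositivePeriod b k) (order b k c)
order-isLeast b k c = proj₂ (leastPositivePeriod b k c)

instance
  order-nonZero : ∀ {b k} .{{_ : NonZero k}} {c : Coprime b k} →
                  NonZero (order b k c)
  order-nonZero {b} {k} {c} = >-nonZero (proj₁ (proj₁ (order-isLeast b k c)))

weight : Expansion 2 → ℕ
weight ds = sumᴸ (List.map toℕ ds)

digitSum₂ : ℕ → ℕ
digitSum₂ n = weight (proj₁ (toDigits 2 n))

-- The binary expansion returned by toDigits may be replaced by any other one.

∷-injective-value : ∀ (d e : Fin 2) x y → toℕ d + x * 2 ≡ toℕ e + y * 2 →
                    toℕ d ≡ toℕ e × x ≡ y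
∷-injective-value d e x y eq = d≡e , *-cancelʳ-≡ x y 2
  (+-cancelˡ-≡ (toℕ d) _ _ (trans eq (cong (_+ y * 2) (sym d≡e))))
  where
  bit%2 : ∀ (d : Fin 2) x → (toℕ d + x * 2) % 2 ≡ toℕ d
  bit%2 zero       x = [m+kn]%n≡m%n 0 x 2
  bit%2 (suc zero) x = [m+kn]%n≡m%n 1 x 2

  d≡e : toℕ d ≡ toℕ e
  d≡e = trans (sym (bit%2 d x)) (trans (cong (_% 2) eq) (bit%2 e y))

weight-unique : ∀ ds es → fromDigits ds ≡ fromDigits es → weight ds ≡ weight es
weight-unique []       []       eq = refl
weight-unique []       (e ∷ es) eq with ∷-injective-value zero e 0 _ eq
... | 0≡e , eq′ = cong₂ _+_ 0≡e (weight-unique [] es eq′)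
weight-unique (d ∷ ds) []       eq with ∷-injective-value d zero _ 0 eq
... | d≡0 , eq′ = cong₂ _+_ d≡0 (weight-unique ds [] eq′)
weight-unique (d ∷ ds) (e ∷ es) eq with ∷-injective-value d e _ _ eq
... | d≡e , eq′ = cong₂ _+_ d≡e (weight-unique ds es eq′)

digitSum₂-fromDigits : ∀ ds → digitSum₂ (fromDigits ds) ≡ weight ds
digitSum₂-fromDigits ds with toDigits 2 (fromDigits ds)
... | es , eq = weight-unique es ds eq

digitSum₂-∷ : ∀ (d : Fin 2) n → digitSum₂ (toℕ d + n * 2) ≡ toℕ d + digitSum₂ n
digitSum₂-∷ d n = begin
  digitSum₂ (toℕ d + n * 2)
    ≡⟨ cong (λ x → digitSum₂ (toℕ d + x * 2)) (proj₂ (toDigits 2 n)) ⟨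
  digitSum₂ (fromDigits (d ∷ proj₁ (toDigits 2 n)))
    ≡⟨ digitSum₂-fromDigits (d ∷ proj₁ (toDigits 2 n)) ⟩
  toℕ d + digitSum₂ n ∎
  where open ≡-Reasoning

digitSum₂-2^* : ∀ p n → digitSum₂ (2 ^ p * n) ≡ digitSum₂ n
digitSum₂-2^* zero    n = cong digitSum₂ (*-identityˡ n)
digitSum₂-2^* (suc p) n = begin
  digitSum₂ (2 * 2 ^ p * n)   ≡⟨ cong digitSum₂ (*-assoc 2 (2 ^ p) n) ⟩
  digitSum₂ (2 * (2 ^ p * n)) ≡⟨ cong digitSum₂ (*-comm 2 (2 ^ p * n)) ⟩
  digitSum₂ (2 ^ p * n * 2)   ≡⟨ digitSum₂-∷ zero (2 ^ p * n) ⟩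
  digitSum₂ (2 ^ p * n)       ≡⟨ digitSum₂-2^* p n ⟩
  digitSum₂ n                 ∎
  where open ≡-Reasoning

Candidate : ℕ → Pred ℕ 0ℓ
Candidate k n = 0 < n × k ∣ n × digitSum₂ n ≡ k

-- If k divides 2^i (2^p - 1) with p positive, then a candidate is
-- 2^i (1 + 2^p + ... + 2^((k-1)p)).

candidate : ∀ k .{{_ : NonZero k}} → ∃ (Candidate k)
candidate k with powers-eventually-periodic 2 k
... | i , suc p , _ , k∣ = n , n>0 , k∣n , n-digitSum
  where
  F : ℕ → ℕ
  F zero    = 0
  F (suc l) = 1 + 2 ^ suc p * F l

  n = 2 ^ i * F k

  n-digitSum : digitSum₂ n ≡ k
  n-digitSum = trans (digitSum₂-2^* i (F k)) (F-digitSum k)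
    where
    shift : ∀ q x → 2 * q * x ≡ q * x * 2
    shift = solve-∀

    F-digitSum : ∀ l → digitSum₂ (F l) ≡ l
    F-digitSum zero    = refl
    F-digitSum (suc l) = begin
      digitSum₂ (1 + 2 * 2 ^ p * F l)
        ≡⟨ cong (digitSum₂ ∘ suc) (shift (2 ^ p) (F l)) ⟩
      digitSum₂ (1 + 2 ^ p * F l * 2)
        ≡⟨ digitSum₂-∷ (suc zero) (2 ^ p * F l) ⟩
      1 + digitSum₂ (2 ^ p * F l)
        ≡⟨ cong suc (digitSum₂-2^* p (F l)) ⟩
      1 + digitSum₂ (F l)
        ≡⟨ cong suc (F-digitSum l) ⟩
      suc l ∎
      where open ≡-Reasoning

  n>0 : 0 < n
  n>0 = n≢0⇒n>0 λ n≡0 →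
    ≢-nonZero⁻¹ k (trans (sym n-digitSum) (cong digitSum₂ n≡0))

  G : ℕ → ℕ
  G zero    = 0
  G (suc l) = G l + F l

  δ = ∣ 2 ^ suc p - 1 ∣

  2^p≡1+δ : 2 ^ suc p ≡ 1 + δ
  2^p≡1+δ = begin
    2 ^ suc p              ≡⟨ m+[n∸m]≡n (m^n>0 2 (suc p)) ⟨
    1 + (2 ^ suc p ∸ 1)    ≡⟨ cong suc (m≤n⇒∣n-m∣≡n∸m (m^n>0 2 (suc p))) ⟨
    1 + δ                  ∎
    where open ≡-Reasoning

  F≡ : ∀ l → F l ≡ l + δ * G l
  F≡ zero    = sym (*-zeroʳ δ)
  F≡ (suc l) = begin
    1 + 2 ^ suc p * F l           ≡⟨ cong (λ x → 1 + x * F l) 2^p≡1+δ ⟩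
    1 + (F l + δ * F l)           ≡⟨ cong (λ x → 1 + (x + δ * F l)) (F≡ l) ⟩
    1 + (l + δ * G l + δ * F l)   ≡⟨ regroup l δ (G l) (F l) ⟩
    suc l + δ * (G l + F l)       ∎
    where
    open ≡-Reasoning
    regroup : ∀ l δ g f → 1 + (l + δ * g + δ * f) ≡ suc l + δ * (g + f)
    regroup = solve-∀

  k∣n : k ∣ n
  k∣n = subst (k ∣_) (sym n≡)
    (∣m∣n⇒∣m+n (n∣m*n (2 ^ i)) (∣m⇒∣m*n (G k) k∣))
    where
    expand : ∀ q l δ g → q * (l + δ * g) ≡ q * l + q * δ * g
    expand = solve-∀
    n≡ : n ≡ 2 ^ i * k + 2 ^ i * δ * G k
    n≡ = trans (cong (2 ^ i *_) (F≡ k)) (expand (2 ^ i) k δ (G k))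

leastCandidate : ∀ k .{{_ : NonZero k}} → ∃ (IsLeast (Candidate k))
leastCandidate k =
  least (λ n → (0 <? n) ×-dec (k ∣? n) ×-dec (digitSum₂ n ≟ k)) n p
  where
  n = proj₁ (candidate k)
  p = proj₂ (candidate k)

a : ∀ k → .{{NonZero k}} → ℕ
a k = proj₁ (leastCandidate k)

a-isLeast : ∀ k .{{_ : NonZero k}} → IsLeast (Candidate k) (a k)
a-isLeast k = proj₂ (leastCandidate k)

-- The division is exact, since k ∣ a k.

c : ∀ k → .{{NonZero k}} → ℕ
c k = a k / k

c/2^ : ∀ k → .{{NonZero k}} → ℚ
c/2^ k = ((+ c k) ℚ./ (2 ^ k)) {{m^n≢0 2 k}}

-- Odd already excludes k = 0, and m + k ≥ 2, so no subtraction truncates.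

𝒞 : ∀ m → .{{NonZero m}} → Pred ℕ 0ℓ
𝒞 m k = Odd k × ∃ λ (j : Vec ℕ m) →
  Linked _<_ j ×
  All (_≤ m + k ∸ 2) j ×
  2 ^ (k + m) ∸ 1 ≡ Vec.sum (Vec.map (2 ^_) j) [mod k ]

-- x k tends to L as k → ∞ through S; rational ε suffice.

Tendsto : (∀ k → .{{NonZero k}} → ℚ) → ℚ → Pred ℕ 0ℓ → Set
Tendsto x L S = ∀ ε → 0ℚ ℚ.< ε →
  ∃ λ N → ∀ k .{{_ : NonZero k}} → N ≤ k → k ∈ S → ℚ.∣ x k ℚ.- L ∣ ℚ.< ε

{-# OPTIONS --safe #-}

-- The numbers below 2 ^ (k + 1) with binary digit sum k are those with exactly
-- one zero among k + 1 digits, that is 2 ^ (k + 1) - 1 - 2 ^ j with j ≤ k.  Such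
-- a number is a multiple of k iff 2 ^ (k + 1) - 1 ≡ 2 ^ j (mod k), and j = k is
-- impossible because k ∤ 2 ^ k - 1 for k > 1.  So a k belongs to the largest
-- solution j ≤ k - 1, and the solutions form a residue class modulo the order of 2.

module Submission where

open import Defs
open import Data.Digit using (Expansion; fromDigits; toDigits; 0b; 1b)
open import Data.Fin.Base using (zero; suc; toℕ; fromℕ<)
open import Data.Fin.Properties using (pigeonhole; fromℕ<-injective; toℕ<n)
import Data.Integer.Base as ℤ
import Data.Integer.Properties as ℤ
open import Data.List.Base using ([]; _∷_; _++_; replicate)
open import Data.Nat.Base
open import Data.Nat.Coprimality using (Coprime)
open import Data.Nat.Divisibility
open import Data.Nat.DivMod
open import Data.Nat.Induction using (<-rec)
open import Data.Nat.Properties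
open import Data.Nat.Tactic.RingSolver using (solve-∀)
open import Data.Product using (∃; _×_; _,_; proj₁; proj₂; ∃!)
open import Data.Rational.Base as ℚ using (0ℚ)
import Data.Rational.Properties as ℚ
open import Data.Rational.Unnormalised.Base as ℚᵘ using (mkℚᵘ)
import Data.Rational.Unnormalised.Properties as ℚᵘ
open import Data.Vec.Base using ([]; _∷_)
open import Data.Vec.Relation.Unary.All using ([]; _∷_)
open import Function.Base using (case_of_)
open import Relation.Binary.Consequences using (wlog)
open import Relation.Binary.PropositionalEquality
  using (_≡_; refl; sym; trans; cong; cong₂; subst; subst₂; module ≡-Reasoning)
open import Relation.Nullary using (¬_)
open import Relation.Unary using (_∈_)

-- Congruences

≡[mod]-sym : ∀ {k} m n → m ≡ n [mod k ] → n ≡ m [mod k ]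
≡[mod]-sym {k} m n = subst (k ∣_) (∣-∣-comm m n)

-- The distance `∣ m - n ∣` is symmetric, so `m ≤ n` may be assumed; then `n` is `m` plus a multiple
-- of `k`.
≡[mod]⇒%≡% : ∀ k .{{_ : NonZero k}} m n → m ≡ n [mod k ] → m % k ≡ n % k
≡[mod]⇒%≡% k = wlog ≤-total
  (λ {m} {n} m≡n⇒eq n≡m → sym (m≡n⇒eq (≡[mod]-sym n m n≡m)))
  λ m n m≤n m≡n → let open ≡-Reasoning in
    case subst (k ∣_) (m≤n⇒∣m-n∣≡n∸m m≤n) m≡n of λ where
      (divides q n∸m≡q*k) → begin
        m % k               ≡⟨ [m+kn]%n≡m%n m q k ⟨
        (m + q * k) % k     ≡⟨ cong (λ x → (m + x) % k) n∸m≡q*k ⟨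
        (m + (n ∸ m)) % k   ≡⟨ cong (_% k) (m+[n∸m]≡n m≤n) ⟩
        n % k               ∎

≡[mod]-trans : ∀ {m n o k} .{{_ : NonZero k}} →
               m ≡ n [mod k ] → n ≡ o [mod k ] → m ≡ o [mod k ]
≡[mod]-trans {m} {n} {o} {k} m≡n n≡o = %≡%⇒≡[mod] m o k
  (trans (≡[mod]⇒%≡% k m n m≡n) (≡[mod]⇒%≡% k n o n≡o))

*-cong-% : ∀ {m m′ n n′} k .{{_ : NonZero k}} →
           m % k ≡ m′ % k → n % k ≡ n′ % k → m * n % k ≡ m′ * n′ % k
*-cong-% {m} {m′} {n} {n′} k m≡m′ n≡n′ = begin
  m * n % k                  ≡⟨ %-distribˡ-* m n k ⟩
  (m % k) * (n % k) % k      ≡⟨ cong₂ (λ x y → x * y % k) m≡m′ n≡n′ ⟩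
  (m′ % k) * (n′ % k) % k    ≡⟨ %-distribˡ-* m′ n′ k ⟨
  m′ * n′ % k                ∎
  where open ≡-Reasoning

-- Multiplicative order

-- The distance factors as `b ^ i * ∣ b ^ (j ∸ i) - 1 ∣`, and coprimality cancels the first factor.
^-cancelˡ-≡[mod] : ∀ {b k} → Coprime b k → ∀ {i j} → i ≤ j →
                   b ^ i ≡ b ^ j [mod k ] → b ^ (j ∸ i) ≡ 1 [mod k ]
^-cancelˡ-≡[mod] {b} {k} coprime {i} {j} i≤j eq = cancel-^ coprime i (subst (k ∣_) factor eq)
  where
  open ≡-Reasoning
  factor : ∣ b ^ i - b ^ j ∣ ≡ b ^ i * ∣ b ^ (j ∸ i) - 1 ∣
  factor = begin
    ∣ b ^ i - b ^ j ∣
      ≡⟨ ∣-∣-comm (b ^ i) (b ^ j) ⟩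
    ∣ b ^ j - b ^ i ∣
      ≡⟨ cong₂ (λ e x → ∣ b ^ e - x ∣) (m+[n∸m]≡n i≤j) (*-identityʳ _) ⟨
    ∣ b ^ (i + (j ∸ i)) - b ^ i * 1 ∣
      ≡⟨ cong (λ x → ∣ x - b ^ i * 1 ∣) (^-distribˡ-+-* b i (j ∸ i)) ⟩
    ∣ b ^ i * b ^ (j ∸ i) - b ^ i * 1 ∣
      ≡⟨ *-distribˡ-∣-∣ (b ^ i) _ _ ⟨
    b ^ i * ∣ b ^ (j ∸ i) - 1 ∣ ∎

module _ {b k t} .{{_ : NonZero k}} .{{_ : NonZero t}}
         (coprime : Coprime b k) (t-order : IsLeast (PositivePeriod b k) t) where

  ^-order : b ^ t ≡ 1 [mod k ]
  ^-order = proj₂ (proj₁ t-order)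

  order-minimal : ∀ {p} → 0 < p → b ^ p ≡ 1 [mod k ] → t ≤ p
  order-minimal 0<p b^p≡1 = proj₂ t-order _ (0<p , b^p≡1)

  ^-order-multiple : ∀ q → b ^ (q * t) % k ≡ 1 % k
  ^-order-multiple zero    = refl
  ^-order-multiple (suc q) = trans
    (cong (_% k) (^-distribˡ-+-* b t (q * t)))
    (*-cong-% k (≡[mod]⇒%≡% k (b ^ t) 1 ^-order) (^-order-multiple q))

  ^-%-order : ∀ x → b ^ x % k ≡ b ^ (x % t) % k
  ^-%-order x = begin
    b ^ x % k
      ≡⟨ cong (λ e → b ^ e % k) (m≡m%n+[m/n]*n x t) ⟩
    b ^ (x % t + x / t * t) % k
      ≡⟨ cong (_% k) (^-distribˡ-+-* b (x % t) (x / t * t)) ⟩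
    b ^ (x % t) * b ^ (x / t * t) % k
      ≡⟨ *-cong-% {m = b ^ (x % t)} k refl (^-order-multiple (x / t)) ⟩
    b ^ (x % t) * 1 % k
      ≡⟨ cong (_% k) (*-identityʳ _) ⟩
    b ^ (x % t) % k ∎
    where open ≡-Reasoning

  %-order⇒^-≡[mod] : ∀ x y → x % t ≡ y % t → b ^ x ≡ b ^ y [mod k ]
  %-order⇒^-≡[mod] x y eq = %≡%⇒≡[mod] (b ^ x) (b ^ y) k
    (trans (^-%-order x) (trans (cong (λ e → b ^ e % k) eq) (sym (^-%-order y))))

  -- If `x < y`, then `y ∸ x` would be a positive period smaller than `t`.
  ^-injective-<order : ∀ x y → x < t → y < t → b ^ x ≡ b ^ y [mod k ] → x ≡ y
  ^-injective-<order = wlog ≤-total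
    (λ {x} {y} x≡y y<t x<t eq → sym (x≡y x<t y<t (≡[mod]-sym (b ^ y) (b ^ x) eq)))
    λ x y x≤y _ y<t eq → ≤-antisym x≤y (≮⇒≥ λ x<y → <⇒≱ y<t
      (≤-trans (order-minimal (m<n⇒0<n∸m x<y) (^-cancelˡ-≡[mod] coprime x≤y eq)) (m∸n≤m y x)))

  ^-≡[mod]⇒%-order : ∀ x y → b ^ x ≡ b ^ y [mod k ] → x % t ≡ y % t
  ^-≡[mod]⇒%-order x y eq = ^-injective-<order _ _ (m%n<n x t) (m%n<n y t)
    (%≡%⇒≡[mod] (b ^ (x % t)) (b ^ (y % t)) k
      (trans (sym (^-%-order x)) (trans (≡[mod]⇒%≡% k (b ^ x) (b ^ y) eq) (^-%-order y))))

  order-∣ : ∀ {p} → b ^ p ≡ 1 [mod k ] → t ∣ p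
  order-∣ {p} b^p≡1 = m%n≡0⇒n∣m p t
    (trans (^-≡[mod]⇒%-order p 0 b^p≡1) (m<n⇒m%n≡m (>-nonZero⁻¹ t)))

  -- The k powers with exponents below k take at most k - 1 nonzero residues.
  order-< : 1 < k → t < k
  order-< 1<k =
    case pigeonhole (≤-reflexive (suc-pred k)) (λ i → fromℕ< (pred-residue< (toℕ i))) of λ where
      (i , j , i<j , eq) → ≤-<-trans
        (order-minimal (m<n⇒0<n∸m i<j) (^-cancelˡ-≡[mod] coprime (<⇒≤ i<j)
          (%≡%⇒≡[mod] (b ^ toℕ i) (b ^ toℕ j) k
            (pred-injective {{residue≢0 (toℕ i)}} {{residue≢0 (toℕ j)}}
              (fromℕ<-injective _ _ _ _ eq)))))
        (≤-<-trans (m∸n≤m (toℕ j) (toℕ i)) (toℕ<n j))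
    where
    residue≢0 : ∀ i → NonZero (b ^ i % k)
    residue≢0 i = ≢-nonZero λ b^i%k≡0 → <⇒≢ 1<k (sym (∣1⇒≡1 (cancel-^ coprime i
      (subst (k ∣_) (sym (*-identityʳ (b ^ i))) (m%n≡0⇒n∣m (b ^ i) k b^i%k≡0)))))

    -- Shifting the nonzero residues down by one fits them into `pred k` pigeonholes, against `k`
    -- exponents.
    pred-residue< : ∀ i → pred (b ^ i % k) < pred k
    pred-residue< i = pred-mono-< {{residue≢0 i}} (m%n<n (b ^ i) k)

-- Infinite descent: if k ∣ 2 ^ k - 1, then the order t of 2 modulo k divides k,
-- so t ∣ 2 ^ t - 1 with 1 < t < k.

2^k≢1[mod-k] : ∀ k → 1 < k → Coprime 2 k → ¬ 2 ^ k ≡ 1 [mod k ]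
2^k≢1[mod-k] = <-rec P λ k rec 1<k coprime 2^k≡1 →
  let instance _ = >-nonZero (<-trans z<s 1<k)
  in descend rec 1<k coprime 2^k≡1 (order-isLeast 2 k coprime)
  where
  P : ℕ → Set
  P k = 1 < k → Coprime 2 k → ¬ 2 ^ k ≡ 1 [mod k ]

  descend : ∀ {k t} .{{k-nonZero : NonZero k}} →
            (∀ {t} → t < k → P t) →
            1 < k → Coprime 2 k → 2 ^ k ≡ 1 [mod k ] →
            ¬ IsLeast (PositivePeriod 2 k) t
  descend {k} {t} {{k-nonZero}} rec 1<k coprime 2^k≡1 t-order@((0<t , 2^t≡1) , _) =
    rec (order-< {{k-nonZero}} {{t-nonZero}} coprime t-order 1<k)
      -- `t = 1` would make `k` divide `2 ^ 1 - 1 = 1`.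
      (≤∧≢⇒< 0<t λ 1≡t → <⇒≢ 1<k
        (sym (∣1⇒≡1 (subst (λ t → 2 ^ t ≡ 1 [mod k ]) (sym 1≡t) 2^t≡1))))
      (λ (d∣2 , d∣t) → coprime (d∣2 , ∣-trans d∣t t∣k))
      (∣-trans t∣k 2^t≡1)
    where
    -- Passed explicitly: instance search would try to unify t with the
    -- computed order in Defs.order-nonZero.
    t-nonZero : NonZero t
    t-nonZero = >-nonZero 0<t

    t∣k : t ∣ k
    t∣k = order-∣ {{k-nonZero}} {{t-nonZero}} coprime t-order 2^k≡1

-- Binary expansions with a single zero

-- Digits run from least to most significant, so the zero sits at the place of value `2 ^ j`.
hole : ℕ → ℕ → Expansion 2
hole j i = replicate j 1b ++ 0b ∷ replicate i 1b

weight-ones : ∀ i → weight (replicate i 1b) ≡ i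
weight-ones zero    = refl
weight-ones (suc i) = cong suc (weight-ones i)

weight-hole : ∀ j i → weight (hole j i) ≡ j + i
weight-hole zero    i = weight-ones i
weight-hole (suc j) i = cong suc (weight-hole j i)

fromDigits-ones : ∀ i → suc (fromDigits (replicate i 1b)) ≡ 2 ^ i
fromDigits-ones zero    = refl
fromDigits-ones (suc i) = trans (double _) (cong (2 *_) (fromDigits-ones i))
  where
  double : ∀ x → suc (1 + x * 2) ≡ 2 * suc x
  double = solve-∀

zero-digit : ∀ x → suc (x * 2 + 1) ≡ 2 * suc x
zero-digit = solve-∀

one-digit : ∀ x y → suc (1 + x * 2 + 2 * y) ≡ 2 * suc (x + y)
one-digit = solve-∀

-- Filling the zero with `2 ^ j` leaves `j + i + 1` ones, one short of a power of 2. In this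
-- additive form no subtraction truncates.
fromDigits-hole : ∀ j i → suc (fromDigits (hole j i) + 2 ^ j) ≡ 2 ^ suc (j + i)
fromDigits-hole zero    i = trans (zero-digit _) (cong (2 *_) (fromDigits-ones i))
fromDigits-hole (suc j) i = trans (one-digit _ (2 ^ j)) (cong (2 *_) (fromDigits-hole j i))

-- A digit one doubles both sides; a digit zero keeps the left side and cannot lower the right one.
2^weight≤ : ∀ ds → 2 ^ weight ds ≤ suc (fromDigits ds)
2^weight≤ []              = ≤-refl
2^weight≤ (zero ∷ ds)     = ≤-trans (2^weight≤ ds) (s≤s (m≤m*n (fromDigits ds) 2))
2^weight≤ (suc zero ∷ ds) = begin
  2 * 2 ^ weight ds            ≤⟨ *-monoʳ-≤ 2 (2^weight≤ ds) ⟩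
  2 * suc (fromDigits ds)      ≡⟨ *-comm 2 (suc (fromDigits ds)) ⟩
  2 + fromDigits ds * 2        ∎
  where open ≤-Reasoning

-- Low ones are stripped, each halving the bound. At the lowest zero the remaining digits, of weight
-- `w`, have value below `2 ^ w`, so `2^weight≤` makes that value exactly `2 ^ w - 1`.
one-zero : ∀ ds → fromDigits ds < 2 ^ suc (weight ds) →
           ∃ λ j → j ≤ weight ds × suc (fromDigits ds + 2 ^ j) ≡ 2 ^ suc (weight ds)
-- The empty expansion is read as a single zero digit at position 0.
one-zero []          _   = 0 , z≤n , refl
one-zero (zero ∷ ds) x<2^ = 0 , z≤n , trans (zero-digit (fromDigits ds))
  (cong (2 *_) (≤-antisym x<2^w (2^weight≤ ds)))
  where
  x<2^w : fromDigits ds < 2 ^ weight ds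
  x<2^w = *-cancelˡ-< 2 _ _ (subst (_< 2 * 2 ^ weight ds) (*-comm (fromDigits ds) 2) x<2^)
one-zero (suc zero ∷ ds) x<2^
  with one-zero ds (*-cancelˡ-< 2 _ _
         (subst (_< 2 * 2 ^ suc (weight ds)) (*-comm (fromDigits ds) 2) (<⇒≤ x<2^)))
... | j , j≤w , eq = suc j , s≤s j≤w , trans (one-digit _ (2 ^ j)) (cong (2 *_) eq)

one-zero-digit : ∀ {n k} → digitSum₂ n ≡ k → n < 2 ^ suc k →
                 ∃ λ j → j ≤ k × suc (n + 2 ^ j) ≡ 2 ^ suc k
one-zero-digit {n} refl = subst
  (λ x → x < 2 ^ suc w → ∃ λ j → j ≤ w × suc (x + 2 ^ j) ≡ 2 ^ suc w)
  (proj₂ (toDigits 2 n)) (one-zero (proj₁ (toDigits 2 n)))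
  where w = digitSum₂ n

-- The least candidate

-- The exponent is `k + 1`, not `suc k`, to match the congruence in `𝒞 1`.
target : ℕ → ℕ
target k = 2 ^ (k + 1) ∸ 1

module _ {k n j} (n-hole : suc (n + 2 ^ j) ≡ 2 ^ suc k) where

  private
    target≡ : target k ≡ n + 2 ^ j
    target≡ = trans (cong (λ e → 2 ^ e ∸ 1) (+-comm k 1)) (cong pred (sym n-hole))

    ∣-∣≡n : ∣ target k - 2 ^ j ∣ ≡ n
    ∣-∣≡n = begin
      ∣ target k - 2 ^ j ∣        ≡⟨ cong ∣_- 2 ^ j ∣ (trans target≡ (+-comm n (2 ^ j))) ⟩
      ∣ 2 ^ j + n - 2 ^ j ∣       ≡⟨ ∣-∣-comm (2 ^ j + n) (2 ^ j) ⟩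
      ∣ 2 ^ j - 2 ^ j + n ∣       ≡⟨ ∣m-m+n∣≡n (2 ^ j) n ⟩
      n                           ∎
      where open ≡-Reasoning

  ∣⇒target≡ : k ∣ n → target k ≡ 2 ^ j [mod k ]
  ∣⇒target≡ = subst (k ∣_) (sym ∣-∣≡n)

  target≡⇒∣ : target k ≡ 2 ^ j [mod k ] → k ∣ n
  target≡⇒∣ = subst (k ∣_) ∣-∣≡n

  hole≡target∸ : n ≡ target k ∸ 2 ^ j
  hole≡target∸ = sym (trans (cong (_∸ 2 ^ j) target≡) (m+n∸n≡m n (2 ^ j)))

  hole<target : n < target k
  hole<target = subst (n <_) (sym target≡) (m<m+n n (m^n>0 2 j))

  -- Since `2 ^ j < 2 ^ k`, removing `2 ^ j` from `2 ^ suc k ∸ 1` leaves more than `2 ^ k ∸ 1`.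
  2^k∸1<hole : j < k → 2 ^ k ∸ 1 < n
  2^k∸1<hole j<k = ≤-trans (≤-reflexive (suc-pred (2 ^ k) {{m^n≢0 2 k}}))
    (+-cancelʳ-≤ (suc (2 ^ j)) (2 ^ k) n (begin
      2 ^ k + suc (2 ^ j)   ≤⟨ +-monoʳ-≤ (2 ^ k) (^-monoʳ-< 2 sz<ss j<k) ⟩
      2 ^ k + 2 ^ k         ≡⟨ cong (2 ^ k +_) (+-identityʳ (2 ^ k)) ⟨
      2 ^ suc k             ≡⟨ n-hole ⟨
      suc (n + 2 ^ j)       ≡⟨ +-suc n (2 ^ j) ⟨
      n + suc (2 ^ j)       ∎))
    where open ≤-Reasoning

-- A zero in the top position leaves `2 ^ k ∸ 1`, which would then be a multiple of `k`.
target≢2^k : ∀ {k} .{{_ : NonZero k}} → 1 < k → Coprime 2 k → ¬ target k ≡ 2 ^ k [mod k ]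
target≢2^k {k} 1<k coprime eq =
  2^k≢1[mod-k] k 1<k coprime (subst (k ∣_) 2^k∸1≡ (target≡⇒∣ {k} {2 ^ k ∸ 1} {k} sum≡ eq))
  where
  sum≡ : suc (2 ^ k ∸ 1 + 2 ^ k) ≡ 2 ^ suc k
  sum≡ = trans (cong (_+ 2 ^ k) (suc-pred (2 ^ k) {{m^n≢0 2 k}}))
    (cong (2 ^ k +_) (sym (+-identityʳ (2 ^ k))))

  2^k∸1≡ : 2 ^ k ∸ 1 ≡ ∣ 2 ^ k - 1 ∣
  2^k∸1≡ = sym (m≤n⇒∣n-m∣≡n∸m (m^n>0 2 k))

-- The number `n` with its zero at `j₁` is a candidate, so `m ≤ n`. Hence `m` is below `2 ^ suc k`
-- and has a single zero too, at a solution `j ≤ j₁`; a lower zero removes less, so `n ≤ m`.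
least-candidate-hole : ∀ k .{{_ : NonZero k}} → 1 < k → Coprime 2 k →
  ∀ {m} → IsLeast (Candidate k) m → ∀ j₁ → j₁ < k →
  target k ≡ 2 ^ j₁ [mod k ] →
  (∀ j → j < k → target k ≡ 2 ^ j [mod k ] → j ≤ j₁) →
  suc (m + 2 ^ j₁) ≡ 2 ^ suc k
least-candidate-hole k 1<k coprime {m} ((_ , k∣m , digitSum≡k) , least)
  j₁ j₁<k j₁-solution j₁-largest = trans
  (cong (λ x → suc (x + 2 ^ j₁)) (≤-antisym m≤n n≤m)) n-hole
  where
  n = fromDigits (hole j₁ (k ∸ j₁))

  n-hole : suc (n + 2 ^ j₁) ≡ 2 ^ suc k
  n-hole = trans (fromDigits-hole j₁ (k ∸ j₁))
    (cong (λ e → 2 ^ suc e) (m+[n∸m]≡n (<⇒≤ j₁<k)))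

  m≤n : m ≤ n
  m≤n = least n
    ( ≤-trans z<s (2^k∸1<hole {k} {n} {j₁} n-hole j₁<k)
    , target≡⇒∣ {k} {n} {j₁} n-hole j₁-solution
    , trans (digitSum₂-fromDigits (hole j₁ (k ∸ j₁)))
        (trans (weight-hole j₁ (k ∸ j₁)) (m+[n∸m]≡n (<⇒≤ j₁<k))))

  n≤m : n ≤ m
  n≤m with one-zero-digit digitSum≡k
    (≤-<-trans m≤n (subst (n <_) n-hole (s≤s (m≤m+n n (2 ^ j₁)))))
  ... | j , j≤k , m-hole = +-cancelʳ-≤ (2 ^ j₁) n m (begin
    n + 2 ^ j₁    ≡⟨ suc-injective (trans n-hole (sym m-hole)) ⟩
    m + 2 ^ j     ≤⟨ +-monoʳ-≤ m (^-monoʳ-≤ 2 (j₁-largest j j<k j-solution)) ⟩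
    m + 2 ^ j₁    ∎)
    where
    open ≤-Reasoning

    j-solution : target k ≡ 2 ^ j [mod k ]
    j-solution = ∣⇒target≡ {k} {m} {j} m-hole k∣m

    j<k : j < k
    j<k = ≤∧≢⇒< j≤k λ j≡k →
      target≢2^k 1<k coprime (subst (λ j → target k ≡ 2 ^ j [mod k ]) j≡k j-solution)

-- The residue class of solutions

-- For one exponent the bound `m + k ∸ 2` is `k ∸ 1`, and the sum is one power of 2 plus 0.
𝒞₁-solution : ∀ {k} → k ∈ 𝒞 1 → ∃ λ j → j ≤ k ∸ 1 × target k ≡ 2 ^ j [mod k ]
𝒞₁-solution {k} (_ , j ∷ [] , _ , j≤ ∷ [] , eq) =
  j , j≤ , subst (target k ≡_[mod k ]) (+-identityʳ (2 ^ j)) eq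

module _ k .{{_ : NonZero k}} (1<k : 1 < k) (k∈𝒞₁ : k ∈ 𝒞 1)
         {t} .{{_ : NonZero t}} (t-order : IsLeast (PositivePeriod 2 k) t) where

  private
    coprime : Coprime 2 k
    coprime = odd⇒coprime (proj₁ k∈𝒞₁)

    j   = proj₁ (𝒞₁-solution k∈𝒞₁)
    j≤  = proj₁ (proj₂ (𝒞₁-solution k∈𝒞₁))
    eqⱼ = proj₂ (proj₂ (𝒞₁-solution k∈𝒞₁))

  IsJ₀ : ℕ → Set
  IsJ₀ j₀ = j₀ < t × target k ≡ 2 ^ j₀ [mod k ]

  -- For `j₀ ≤ k ∸ 1`, the largest number up to `k ∸ 1` reached from `j₀` in steps of `t`.
  lastSolution : ℕ → ℕ
  lastSolution j₀ = j₀ + (k ∸ 1 ∸ j₀) / t * t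

  solutions-%-order : ∀ {x y} → target k ≡ 2 ^ x [mod k ] → target k ≡ 2 ^ y [mod k ] →
                      x % t ≡ y % t
  solutions-%-order {x} {y} eqₓ eqᵧ = ^-≡[mod]⇒%-order coprime t-order x y
    (≡[mod]-trans {2 ^ x} {target k} {2 ^ y} (≡[mod]-sym (target k) (2 ^ x) eqₓ) eqᵧ)

  solution-shift : ∀ {x y} → x % t ≡ y % t →
                   target k ≡ 2 ^ x [mod k ] → target k ≡ 2 ^ y [mod k ]
  solution-shift {x} {y} x≡y eqₓ =
    ≡[mod]-trans {target k} {2 ^ x} {2 ^ y} eqₓ (%-order⇒^-≡[mod] coprime t-order x y x≡y)

  -- The witness is the exponent supplied by `𝒞 1`, reduced modulo the order.
  ∃!-IsJ₀ : ∃! _≡_ IsJ₀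
  ∃!-IsJ₀ = j % t
    , (m%n<n j t , solution-shift (sym (m%n%n≡m%n j t)) eqⱼ)
    , λ (y<t , eqᵧ) → trans (solutions-%-order eqⱼ eqᵧ) (m<n⇒m%n≡m y<t)

  module _ {j₀} (isJ₀ : IsJ₀ j₀) where

    private
      s  = (k ∸ 1 ∸ j₀) / t
      j₁ = lastSolution j₀

      solution≡ : ∀ {x} → target k ≡ 2 ^ x [mod k ] → j₀ + x / t * t ≡ x
      solution≡ {x} eqₓ = sym (trans (m≡m%n+[m/n]*n x t) (cong (_+ x / t * t)
        (trans (solutions-%-order eqₓ (proj₂ isJ₀)) (m<n⇒m%n≡m (proj₁ isJ₀)))))

      -- `j₀` is the remainder of the solution `j ≤ k ∸ 1`, so the subtraction inside `s` does not
      -- truncate.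
      j₀≤k∸1 : j₀ ≤ k ∸ 1
      j₀≤k∸1 = ≤-trans (m+n≤o⇒m≤o j₀ (≤-reflexive (solution≡ eqⱼ))) j≤

    lastSolution< : j₁ < k
    lastSolution< = begin-strict
      j₀ + s * t               ≤⟨ +-monoʳ-≤ j₀ (m/n*n≤m (k ∸ 1 ∸ j₀) t) ⟩
      j₀ + (k ∸ 1 ∸ j₀)        ≡⟨ m+[n∸m]≡n j₀≤k∸1 ⟩
      k ∸ 1                    <⟨ ≤-reflexive (suc-pred k) ⟩
      k                        ∎
      where open ≤-Reasoning

    -- Every solution is `j₀` plus a multiple of `t`, and `x ≤ k ∸ 1` bounds the multiplier by `s`.
    lastSolution-largest : ∀ x → x < k → target k ≡ 2 ^ x [mod k ] → x ≤ j₁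
    lastSolution-largest x x<k eqₓ = begin
      x                   ≡⟨ solution≡ eqₓ ⟨
      j₀ + x / t * t      ≤⟨ +-monoʳ-≤ j₀ (*-monoˡ-≤ t x/t≤s) ⟩
      j₀ + s * t          ∎
      where
      open ≤-Reasoning

      x≤k∸1 : x / t * t + j₀ ≤ k ∸ 1
      x≤k∸1 = ≤-trans (≤-reflexive (trans (+-comm (x / t * t) j₀) (solution≡ eqₓ)))
        (m+n≤o⇒m≤o∸n x (≤-trans (≤-reflexive (+-comm x 1)) x<k))

      x/t≤s : x / t ≤ s
      x/t≤s = begin
        x / t              ≡⟨ m*n/n≡m (x / t) t ⟨
        x / t * t / t      ≤⟨ /-monoˡ-≤ t (m+n≤o⇒m≤o∸n (x / t * t) x≤k∸1) ⟩
        s                  ∎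

    a-lastSolution : suc (a k + 2 ^ j₁) ≡ 2 ^ suc k
    a-lastSolution = least-candidate-hole k 1<k coprime (a-isLeast k) j₁ lastSolution<
      (solution-shift (sym ([m+kn]%n≡m%n j₀ s t)) (proj₂ isJ₀)) lastSolution-largest

    a≡target∸ : a k ≡ target k ∸ 2 ^ j₁
    a≡target∸ = hole≡target∸ {k} {a k} {j₁} a-lastSolution

  lastSolution-exists : ∃ λ j₁ → j₁ < k × suc (a k + 2 ^ j₁) ≡ 2 ^ suc k
  lastSolution-exists = let j₀ , isJ₀ , _ = ∃!-IsJ₀ in
    lastSolution j₀ , lastSolution< isJ₀ , a-lastSolution isJ₀

module _ k .{{_ : NonZero k}} (1<k : 1 < k) (k∈𝒞₁ : k ∈ 𝒞 1) where

  private
    t-order = order-isLeast 2 k (odd⇒coprime (proj₁ k∈𝒞₁))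

  2^k∸1<a : 2 ^ k ∸ 1 < a k
  2^k∸1<a = let j , j<k , eq = lastSolution-exists k 1<k k∈𝒞₁ t-order in
    2^k∸1<hole {k} {a k} {j} eq j<k

  a<target : a k < target k
  a<target = let j , _ , eq = lastSolution-exists k 1<k k∈𝒞₁ t-order in
    hole<target {k} {a k} {j} eq

-- The limit

-- `ℚ._/_` reduces to lowest terms, so the comparison passes through unnormalised rationals, where
-- it is cross-multiplication.
/-< : ∀ m n .{{_ : NonZero n}} ε → ℤ.+ m ℤ.* ℚ.↧ ε ℤ.< ℚ.↥ ε ℤ.* ℤ.+ n → ℤ.+ m ℚ./ n ℚ.< ε
/-< m (suc n) ε@record{} m/n<ε = ℚ.toℚᵘ-cancel-<
  (ℚᵘ.<-respˡ-≃ (ℚᵘ.≃-sym (ℚ.toℚᵘ-fromℚᵘ (mkℚᵘ (ℤ.+ m) n))) (ℚᵘ.*<* m/n<ε))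

∣m/n-0∣≡m/n : ∀ m n .{{_ : NonZero n}} → ℚ.∣ ℤ.+ m ℚ./ n ℚ.- 0ℚ ∣ ≡ ℤ.+ m ℚ./ n
∣m/n-0∣≡m/n m n = trans (cong ℚ.∣_∣ (ℚ.+-identityʳ (ℤ.+ m ℚ./ n)))
  (ℚ.0≤p⇒∣p∣≡p (ℚ.nonNegative⁻¹ _ {{ℚ.normalize-nonNeg m n}}))

-- This bounds `c k / 2 ^ k` by `1 / q`, from `c k * k ≤ a k < 2 ^ (k + 1)` and `2 * q ≤ k`.
c*q<2^k : ∀ k .{{_ : NonZero k}} q → 2 * q ≤ k → a k < target k → c k * q < 2 ^ k
c*q<2^k k q 2q≤k a<target = *-cancelˡ-< 2 _ _ (begin-strict
  2 * (c k * q)   ≡⟨ regroup (c k) q ⟩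
  c k * (2 * q)   ≤⟨ *-monoʳ-≤ (c k) 2q≤k ⟩
  c k * k         ≤⟨ m/n*n≤m (a k) k ⟩
  a k             <⟨ a<target ⟩
  target k        ≤⟨ m∸n≤m (2 ^ (k + 1)) 1 ⟩
  2 ^ (k + 1)     ≡⟨ cong (2 ^_) (+-comm k 1) ⟩
  2 * 2 ^ k       ∎)
  where
  open ≤-Reasoning
  regroup : ∀ x q → 2 * (x * q) ≡ x * (2 * q)
  regroup = solve-∀

c/2^-tendsto-0 : Tendsto c/2^ 0ℚ (𝒞 1)
c/2^-tendsto-0 (ℚ.mkℚ (ℤ.+ zero)    _ _) (ℚ.*<* (ℤ.+<+ ()))
c/2^-tendsto-0 (ℚ.mkℚ ℤ.-[1+ _ ] _ _) (ℚ.*<* ())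
-- Here `ε` is `suc p / suc d`, at least `1 / suc d`, so `q = suc d` suffices. The threshold
-- `2 * suc d` also ensures `1 < k`.
c/2^-tendsto-0 ε@(ℚ.mkℚ ℤ.+[1+ p ] d _) _ = 2 * suc d , bound
  where
  bound : ∀ k .{{_ : NonZero k}} → 2 * suc d ≤ k → k ∈ 𝒞 1 → ℚ.∣ c/2^ k ℚ.- 0ℚ ∣ ℚ.< ε
  bound k 2q≤k k∈𝒞₁ = subst (ℚ._< ε) (sym (∣m/n-0∣≡m/n (c k) (2 ^ k) {{2^k-nonZero}}))
    (/-< (c k) (2 ^ k) {{2^k-nonZero}} ε (subst₂ ℤ._<_ (ℤ.pos-* (c k) (suc d)) (ℤ.pos-* (suc p) (2 ^ k))
      (ℤ.+<+ (<-≤-trans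
        (c*q<2^k k (suc d) 2q≤k (a<target k (≤-trans (m≤m*n 2 (suc d)) 2q≤k) k∈𝒞₁))
        (m≤n*m (2 ^ k) (suc p))))))
    where
    2^k-nonZero : NonZero (2 ^ k)
    2^k-nonZero = m^n≢0 2 k

mainTheorem5 :
    (∀ k .{{_ : NonZero k}} → 1 < k → k ∈ 𝒞 1 →
      2 ^ k ∸ 1 < a k × a k < 2 ^ (k + 1) ∸ 1)
    × Tendsto c/2^ 0ℚ (𝒞 1)
    × (∀ k .{{_ : NonZero k}} → 1 < k → (k∈𝒞₁ : k ∈ 𝒞 1) →
        let t = order 2 k (odd⇒coprime (proj₁ k∈𝒞₁))
            IsJ₀ = λ j₀ → j₀ < t × 2 ^ (k + 1) ∸ 1 ≡ 2 ^ j₀ [mod k ]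
        in ∃! _≡_ IsJ₀
           × (∀ j₀ → IsJ₀ j₀ →
               let s = (k ∸ 1 ∸ j₀) / t
                   j₁ = j₀ + s * t
               in a k ≡ 2 ^ (k + 1) ∸ 1 ∸ 2 ^ j₁))
mainTheorem5 =
    (λ k 1<k k∈𝒞₁ → 2^k∸1<a k 1<k k∈𝒞₁ , a<target k 1<k k∈𝒞₁)
  , c/2^-tendsto-0
  , λ k 1<k k∈𝒞₁ →
      let coprime = odd⇒coprime (proj₁ k∈𝒞₁)
          t-order = order-isLeast 2 k coprime
          t-nonZero = order-nonZero {2} {k} {coprime}
      in ∃!-IsJ₀ k 1<k k∈𝒞₁ {{t-nonZero}} t-order
       , λ j₀ isJ₀ → a≡target∸ k 1<k k∈𝒞₁ {{t-nonZero}} t-order isJ₀
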